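{- For every $n\ge 1$, $$\sum_{\sigma\in\mathcal{S}_n(231)}a^{\operatorname{des}(\sigma)}q^{\operatorname{maj}(\sigma)}t^{\operatorname{imaj}(\sigma)}=\sum_{\sigma\in\mathcal{S}_n(312)}a^{n-1-\operatorname{des}(\sigma)}q^{\binom{n}{2}-\operatorname{maj}(\sigma)}t^{\binom{n}{2}-\operatorname{imaj}(\sigma)}$$ as polynomials in the indeterminates $a,q,t$.
   Context: $\mathcal{S}_n$ is the symmetric group on $\{1,\dots,n\}$. $\mathcal{S}_n(231)$ is the set of $\sigma\in\mathcal{S}_n$ with no $i<j<k$ satisfying $\sigma_k<\sigma_i<\sigma_j$; $\mathcal{S}_n(312)$ is the set of $\sigma\in\mathcal{S}_n$ with no $i<j<k$ satisfying $\sigma_j<\sigma_k<\sigma_i$. The descent set is $\operatorname{Des}(\sigma)=\{i : 1\le i<n,\ \sigma_i>\sigma_{i+1}\}$, $\operatorname{des}(\sigma)=|\operatorname{Des}(\sigma)|$, $\operatorname{maj}(\sigma)=\sum_{i\in\operatorname{Des}(\sigma)}i$, and $\operatorname{imaj}(\sigma)=\operatorname{maj}(\sigma^{ -1})$. -}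

module Defs where

open import Data.Fin.Base using (Fin; zero; suc; toℕ; punchIn) renaming (_<_ to _<ᶠ_)
open import Data.Fin.Properties using (any?; punchIn-injective) renaming (_<?_ to _<ᶠ?_)
open import Data.Fin.Permutation
  using (Permutation′; _⟨$⟩ʳ_; flip; id; insert; remove; insert-remove)
  renaming (_≈_ to _≈ₚ_)
open import Data.Integer.Base using (ℤ; 0ℤ; 1ℤ) renaming (_+_ to _+ᶻ_; _*_ to _*ᶻ_)
open import Data.List.Base
  using (List; []; _∷_; [_]; _++_; map; foldr; filter; length; allFin; cartesianProductWith)
open import Data.List.Membership.Propositional.Properties using (∈-allFin)
import Data.List.Membership.Setoid as SetoidMembership
import Data.List.Membership.Setoid.Properties as SetoidMembershipₚ
open import Data.List.Relation.Unary.All using ([]; _∷_)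
open import Data.List.Relation.Unary.AllPairs using ([]; _∷_)
open import Data.List.Relation.Unary.Any using (here)
import Data.List.Relation.Unary.Unique.Setoid as SetoidUnique
import Data.List.Relation.Unary.Unique.Setoid.Properties as SetoidUniqueₚ
open import Data.List.Relation.Unary.Unique.Propositional.Properties using (allFin⁺)
open import Data.Nat.Base as ℕ using (ℕ; zero; suc)
import Data.Nat.ListAction as ℕ
import Data.Nat.Properties as ℕ
open import Data.Product.Base using (∃-syntax; _×_; _,_; proj₁; proj₂)
open import Data.Vec.Base using (Vec; replicate; zipWith; _[_]≔_)
open import Data.Vec.Properties using (≡-dec)
open import Level using (0ℓ)
open import Relation.Binary.Bundles using (Setoid)
open import Relation.Binary.PropositionalEquality
  using (_≡_; refl; sym; trans; cong; setoid)
open import Relation.Nullary.Decidable.Core using (Dec; ¬?; _×-dec_)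
open import Relation.Nullary.Negation.Core using (¬_)

------------------------------------------------------------------------
-- Polynomials over ℤ in k commuting indeterminates

-- A polynomial is presented as a formal sum of terms c·x^e, with e a
-- multi-index. Presentations are not normalised (terms may repeat or
-- have coefficient 0), so equality of polynomials is _≈_, not _≡_.
Polynomial : ℕ → Set
Polynomial k = List (ℤ × Vec ℕ k)

coefficient : ∀ {k} → Vec ℕ k → Polynomial k → ℤ
coefficient e p =
  foldr _+ᶻ_ 0ℤ (map proj₁ (filter (λ term → ≡-dec ℕ._≟_ (proj₂ term) e) p))

infix 4 _≈_
_≈_ : ∀ {k} → Polynomial k → Polynomial k → Set
p ≈ q = ∀ e → coefficient e p ≡ coefficient e q

infixl 6 _+_
infixl 7 _*_
infixr 8 _^_

0# 1# : ∀ {k} → Polynomial k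
0# = []
1# = [ 1ℤ , replicate _ 0 ]

var : ∀ {k} → Fin k → Polynomial k
var i = [ 1ℤ , replicate _ 0 [ i ]≔ 1 ]

_+_ _*_ : ∀ {k} → Polynomial k → Polynomial k → Polynomial k
_+_ = _++_
_*_ = cartesianProductWith λ (c , e) (d , f) → c *ᶻ d , zipWith ℕ._+_ e f

_^_ : ∀ {k} → Polynomial k → ℕ → Polynomial k
p ^ zero  = 1#
p ^ suc n = p * p ^ n

sumOver : ∀ {A : Set} {k} → List A → (A → Polynomial k) → Polynomial k
sumOver xs f = foldr (λ x p → f x + p) 0# xs

syntax sumOver xs (λ x → p) = ∑[ x ∈ xs ] p

a q t : Polynomial 3
a = var zero
q = var (suc zero)
t = var (suc (suc zero))

------------------------------------------------------------------------
-- The symmetric group as a finite set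

-- Positions and values are 0-based: the value of σ at position toℕ i + 1
-- is toℕ (σ ⟨$⟩ʳ i) + 1. Each σ is determined by its first value j
-- together with the pattern of its remaining values.
permutations : ∀ n → List (Permutation′ n)
permutations zero    = [ id ]
permutations (suc n) = cartesianProductWith (insert zero) (allFin (suc n)) (permutations n)

permutationSetoid : ℕ → Setoid 0ℓ 0ℓ
permutationSetoid n = record
  { Carrier       = Permutation′ n
  ; _≈_           = _≈ₚ_
  ; isEquivalence = record
    { refl  = λ _ → refl
    ; sym   = λ p i → sym (p i)
    ; trans = λ p r i → trans (p i) (r i)
    }
  }

private
  module _ {n : ℕ} where
    insert₀-cong : ∀ {i j : Fin (suc n)} {σ τ : Permutation′ n} →
                   i ≡ j → σ ≈ₚ τ → insert zero i σ ≈ₚ insert zero j τ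
    insert₀-cong i≡j       σ≈τ zero    = i≡j
    insert₀-cong {i} refl σ≈τ (suc k) = cong (punchIn i) (σ≈τ k)

    insert₀-injective : ∀ {i j : Fin (suc n)} {σ τ : Permutation′ n} →
                        insert zero i σ ≈ₚ insert zero j τ → i ≡ j × σ ≈ₚ τ
    insert₀-injective {i} eq with eq zero
    ... | refl = refl , λ k → punchIn-injective i _ _ (eq (suc k))

-- Up to pointwise equality, every permutation is listed exactly once.
permutations-complete : ∀ n (σ : Permutation′ n) →
  SetoidMembership._∈_ (permutationSetoid n) σ (permutations n)
permutations-complete zero    σ = here λ ()
permutations-complete (suc n) σ =
  SetoidMembershipₚ.∈-resp-≈ (permutationSetoid (suc n))
    {x = insert zero (σ ⟨$⟩ʳ zero) (remove zero σ)} {σ} (insert-remove zero σ)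
    (SetoidMembershipₚ.∈-cartesianProductWith⁺
      (setoid (Fin (suc n))) (permutationSetoid n) (permutationSetoid (suc n))
      (λ {i} {j} {σ} {τ} → insert₀-cong {σ = σ} {τ})
      (∈-allFin (σ ⟨$⟩ʳ zero)) (permutations-complete n (remove zero σ)))

permutations-unique : ∀ n → SetoidUnique.Unique (permutationSetoid n) (permutations n)
permutations-unique zero    = [] ∷ []
permutations-unique (suc n) =
  SetoidUniqueₚ.cartesianProductWith⁺
    (setoid (Fin (suc n))) (permutationSetoid n) (permutationSetoid (suc n))
    (insert zero)
    (λ {i} {j} {σ} {τ} → insert₀-injective {σ = σ} {τ})
    (allFin⁺ (suc n)) (permutations-unique n)

------------------------------------------------------------------------
-- Pattern avoidance

module _ {n : ℕ} (σ : Permutation′ n) where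

  Avoids231 Avoids312 : Set
  Avoids231 = ¬ (∃[ i ] ∃[ j ] ∃[ k ] i <ᶠ j × j <ᶠ k ×
                 σ ⟨$⟩ʳ k <ᶠ σ ⟨$⟩ʳ i × σ ⟨$⟩ʳ i <ᶠ σ ⟨$⟩ʳ j)
  Avoids312 = ¬ (∃[ i ] ∃[ j ] ∃[ k ] i <ᶠ j × j <ᶠ k ×
                 σ ⟨$⟩ʳ j <ᶠ σ ⟨$⟩ʳ k × σ ⟨$⟩ʳ k <ᶠ σ ⟨$⟩ʳ i)

  avoids231? : Dec Avoids231
  avoids231? = ¬? (any? λ i → any? λ j → any? λ k →
    i <ᶠ? j ×-dec j <ᶠ? k ×-dec
    σ ⟨$⟩ʳ k <ᶠ? σ ⟨$⟩ʳ i ×-dec σ ⟨$⟩ʳ i <ᶠ? σ ⟨$⟩ʳ j)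

  avoids312? : Dec Avoids312
  avoids312? = ¬? (any? λ i → any? λ j → any? λ k →
    i <ᶠ? j ×-dec j <ᶠ? k ×-dec
    σ ⟨$⟩ʳ j <ᶠ? σ ⟨$⟩ʳ k ×-dec σ ⟨$⟩ʳ k <ᶠ? σ ⟨$⟩ʳ i)

𝒮₂₃₁ 𝒮₃₁₂ : ∀ n → List (Permutation′ n)
𝒮₂₃₁ n = filter avoids231? (permutations n)
𝒮₃₁₂ n = filter avoids312? (permutations n)

------------------------------------------------------------------------
-- Permutation statistics

module _ {n : ℕ} (σ : Permutation′ n) where

  -- The last position is never a descent, as it has no successor in Fin n.
  IsDescent : Fin n → Set
  IsDescent i = ∃[ j ] toℕ j ≡ suc (toℕ i) × σ ⟨$⟩ʳ j <ᶠ σ ⟨$⟩ʳ i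

  isDescent? : ∀ i → Dec (IsDescent i)
  isDescent? i = any? λ j →
    toℕ j ℕ.≟ suc (toℕ i) ×-dec σ ⟨$⟩ʳ j <ᶠ? σ ⟨$⟩ʳ i

  Des : List (Fin n)
  Des = filter isDescent? (allFin n)

  des : ℕ
  des = length Des

  -- suc converts 0-based positions to 1-based ones.
  maj : ℕ
  maj = ℕ.sum (map (λ i → suc (toℕ i)) Des)

imaj : ∀ {n} → Permutation′ n → ℕ
imaj σ = maj (flip σ)

{-# OPTIONS --safe #-}
module Submission where

-- For each σ in S_n(231), the pair (Des σ, Des σ⁻¹) is encoded as a word of n
-- letters (d , e), the i-th of which says whether i lies in Des σ and whether
-- i lies in Des σ⁻¹. Read as steps of height d - e, these words are exactly
-- the two-coloured Motzkin paths of length n - 1, followed by one letter none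
-- (false , false), and σ is determined by its word, as is any statistic that
-- depends only on the two descent sets, such as des, maj and imaj.
--
-- Complementing and exchanging the two sets exchanges the two colours of level
-- steps and fixes the up and down steps, so it permutes Motzkin paths. Since
-- S_n(312) consists of the inverses of S_n(231), the pairs of complements
-- of Des τ and Des τ⁻¹ in {1, ..., n - 1}, for τ in S_n(312), run through the
-- same words, each once. Passing to complements turns des, maj and imaj into
-- n - 1 - des, C(n,2) - maj and C(n,2) - imaj, so the two sums have the same
-- terms up to order (words-↭).
--
-- The bijection between avoiders and Motzkin paths goes by induction on n. A
-- permutation with first value j (counted from 0) and remaining pattern ρ
-- avoids 231 iff ρ does and the values of ρ below j come first. In the word
-- of ρ this says that j = 0 or that the j-th letter is none at height 0
-- (smallFirst⇒return, return⇒smallFirst), and the new word is obtained by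
-- shifting the first components of the letters before that one (word-prepend).
-- The shift is a bijection from Motzkin paths to nonempty paths that do not use
-- none at height 0, so that cutting a path at its first none at height 0
-- recovers j and the word of ρ (prepend-injective, prepend-surjective).

open import Defs
open import Data.Nat.Base using (ℕ; _≥_; _∸_)
open import Data.Nat.Combinatorics using (_C_; nC1≡n; nCk+nC[k+1]≡[n+1]C[k+1])
open import Data.Bool.Base using (Bool; true; false; not)
open import Data.Fin.Base using (Fin; zero; suc; toℕ; fromℕ<; punchIn) renaming (_<_ to _<ᶠ_)
import Data.Fin.Properties as Fin
open import Data.Fin.Permutation
  using (Permutation′; _⟨$⟩ʳ_; _⟨$⟩ˡ_; flip; id; insert; remove; insert-remove; inverseʳ; inverseˡ)
  renaming (_≈_ to _≈ₚ_)
open import Data.Integer.Base using (ℤ; 1ℤ)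
import Data.Integer.Properties as ℤ
open import Data.List.Base
  using (List; []; _∷_; [_]; _++_; map; length; zip; filter; tabulate)
open import Data.List.Properties
  using (∷-injectiveˡ; ∷-injectiveʳ; ++-assoc; ++-conicalʳ; length-++; length-zipWith; map-∘)
open import Data.List.Membership.Propositional using (_∈_; find)
open import Data.List.Membership.Propositional.Properties
  using (∈-map⁺; ∈-map⁻; ∈-filter⁺; ∈-filter⁻)
open import Data.List.Membership.Propositional.Properties.WithK using (unique∧set⇒bag)
open import Data.List.Relation.Binary.BagAndSetEquality using (∼bag⇒↭)
open import Data.List.Relation.Binary.Permutation.Propositional using (_↭_; ↭⇒↭ₛ)
open import Data.List.Relation.Binary.Permutation.Propositional.Properties using (filter-↭)
  renaming (map⁺ to ↭-map⁺)
import Data.List.Relation.Binary.Permutation.Setoid.Properties as ↭ₛ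
open import Data.List.Relation.Unary.All as All using (All; []; _∷_)
import Data.List.Relation.Unary.All.Properties as All
open import Data.List.Relation.Unary.AllPairs using (AllPairs; []; _∷_)
import Data.List.Relation.Unary.AllPairs.Properties as AllPairs
open import Data.List.Relation.Unary.Unique.Propositional using (Unique)
open import Data.Nat.Base as ℕ using (zero; suc; z≤n; s≤s)
import Data.Nat.ListAction as ℕ
import Data.Nat.Properties as ℕ
open import Data.Nat.Solver using (module +-*-Solver)
open import Data.Product.Base using (∃-syntax; _×_; _,_; proj₁; proj₂)
open import Data.Sum.Base using (_⊎_; inj₁; inj₂)
open import Data.Vec.Base using (Vec; []; _∷_)
import Data.Vec.Properties as Vec
open import Function.Base using (_∘_)
open import Function.Bundles using (_⇔_; mk⇔)
open import Function.Properties.Equivalence using () renaming (sym to ⇔-sym; trans to ⇔-trans)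
open import Relation.Binary.Definitions using (tri<; tri≈; tri>)
open import Relation.Binary.PropositionalEquality
  using (_≡_; _≢_; refl; sym; trans; cong; cong₂; subst; subst₂; setoid; module ≡-Reasoning)
open import Relation.Nullary.Decidable.Core using (Dec; does)
open import Relation.Nullary.Decidable as Dec using (does-⇔; dec-true; dec-false)
open import Relation.Nullary.Negation.Core using (¬_; contradiction)

------------------------------------------------------------------------
-- Two-coloured Motzkin paths

-- A letter (d , e) records, for one index i, whether i is a descent of a
-- permutation (d) and whether it is a descent of its inverse (e). Read as a
-- step of a lattice path, it changes the height by d - e.
Letter : Set
Letter = Bool × Bool

pattern up   = true  , false
pattern down = false , true
pattern both = true  , true
pattern none = false , false

private variable
  h i j n : ℕ
  v v′ w w′ x y z : List Letter
  bs cs : List Bool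

-- Motzkin h w: started at height h, the path w never goes below 0 and ends
-- at 0. The two level letters, both and none, are the two colours.
data Motzkin : ℕ → List Letter → Set where
  []    : Motzkin 0 []
  up∷   : Motzkin (suc h) w → Motzkin h (up ∷ w)
  down∷ : Motzkin h w → Motzkin (suc h) (down ∷ w)
  both∷ : Motzkin h w → Motzkin h (both ∷ w)
  none∷ : Motzkin h w → Motzkin h (none ∷ w)

-- Paths as in Motzkin that moreover do not use the letter none at height 0.
data Prime : ℕ → List Letter → Set where
  []    : Prime 0 []
  up∷   : Prime (suc h) w → Prime h (up ∷ w)
  down∷ : Prime h w → Prime (suc h) (down ∷ w)
  both∷ : Prime h w → Prime h (both ∷ w)
  none∷ : Prime (suc h) w → Prime (suc h) (none ∷ w)

prime⇒motzkin : Prime h w → Motzkin h w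
prime⇒motzkin []        = []
prime⇒motzkin (up∷ p)   = up∷ (prime⇒motzkin p)
prime⇒motzkin (down∷ p) = down∷ (prime⇒motzkin p)
prime⇒motzkin (both∷ p) = both∷ (prime⇒motzkin p)
prime⇒motzkin (none∷ p) = none∷ (prime⇒motzkin p)

motzkin-++ : Motzkin h v → Motzkin 0 w → Motzkin h (v ++ w)
motzkin-++ []        q = q
motzkin-++ (up∷ p)   q = up∷ (motzkin-++ p q)
motzkin-++ (down∷ p) q = down∷ (motzkin-++ p q)
motzkin-++ (both∷ p) q = both∷ (motzkin-++ p q)
motzkin-++ (none∷ p) q = none∷ (motzkin-++ p q)

motzkin-drop : Motzkin h v → Motzkin h (v ++ w) → Motzkin 0 w
motzkin-drop []        q         = q
motzkin-drop (up∷ p)   (up∷ q)   = motzkin-drop p q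
motzkin-drop (down∷ p) (down∷ q) = motzkin-drop p q
motzkin-drop (both∷ p) (both∷ q) = motzkin-drop p q
motzkin-drop (none∷ p) (none∷ q) = motzkin-drop p q

motzkin-∷⁻ : Motzkin 0 (none ∷ w) → Motzkin 0 w
motzkin-∷⁻ (none∷ p) = p

------------------------------------------------------------------------
-- Shifting a path

-- Moves the descents of the permutation one place to the right, with c
-- entering on the left, and appends a descent of the inverse. For c = true
-- this is what putting a new largest value in front of a nonempty permutation
-- does to its word, the final none apart.
shift : Bool → List Letter → List Letter
shift c []            = [ c , true ]
shift c ((d , e) ∷ x) = (c , e) ∷ shift d x

length-shift : ∀ c x → length (shift c x) ≡ suc (length x)
length-shift c []            = refl
length-shift c ((d , e) ∷ x) = cong suc (length-shift d x)

shift-head : ∀ c x → ∃[ e ] ∃[ r ] shift c x ≡ (c , e) ∷ r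
shift-head c []            = true , [] , refl
shift-head c ((d , e) ∷ x) = e , shift d x , refl

shift-injective : ∀ c x y → shift c x ≡ shift c y → x ≡ y
shift-injective c []            []            eq = refl
shift-injective c []            ((d , e) ∷ y) eq with shift-head d y
... | _ , _ , eq′ with () ← trans (∷-injectiveʳ eq) eq′
shift-injective c ((d , e) ∷ x) []            eq with shift-head d x
... | _ , _ , eq′ with () ← trans (sym (∷-injectiveʳ eq)) eq′
shift-injective c ((d , e) ∷ x) ((d′ , e′) ∷ y) eq
  with shift-head d x | shift-head d′ y
... | _ , _ , eq₁ | _ , _ , eq₂
  with refl ← ∷-injectiveˡ eq
     | refl ← ∷-injectiveˡ (trans (sym eq₁) (trans (∷-injectiveʳ eq) eq₂))
  = cong (_ ∷_) (shift-injective d x y (∷-injectiveʳ eq))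

-- The height of the path shifted by true when the original one has reached
-- height h with c as its last first component: the shifted path has read the
-- initial true but not yet c, so it is at h + 1 - c.
carry : Bool → ℕ → ℕ
carry true  h = h
carry false h = suc h

shift-prime : ∀ c → Motzkin h x → Prime (carry c h) (shift c x)
shift-prime true  []        = both∷ []
shift-prime false []        = down∷ []
shift-prime true  (up∷ p)   = up∷ (shift-prime true p)
shift-prime false (up∷ p)   = none∷ (shift-prime true p)
shift-prime true  (down∷ p) = both∷ (shift-prime false p)
shift-prime false (down∷ p) = down∷ (shift-prime false p)
shift-prime true  (both∷ p) = both∷ (shift-prime true p)
shift-prime false (both∷ p) = down∷ (shift-prime true p)
shift-prime true  (none∷ p) = up∷ (shift-prime false p)
shift-prime false (none∷ p) = none∷ (shift-prime false p)

prime-tail : ∀ c e → Prime (carry c h) ((c , e) ∷ z) → Prime (carry e h) z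
prime-tail true  true  (both∷ p) = p
prime-tail true  false (up∷ p)   = p
prime-tail false true  (down∷ p) = p
prime-tail false false (none∷ p) = p

-- The height of the unshifted path is recovered from the next bit d. The
-- only failing case would be d false, e true at h = 0, which primality
-- excludes.
prime-step : ∀ d e {e′} → Prime (carry e h) ((d , e′) ∷ z) →
             ∃[ h′ ] carry d h′ ≡ carry e h × (∀ {x} → Motzkin h′ x → Motzkin h ((d , e) ∷ x))
prime-step {h}     true  true  p         = h , refl , both∷
prime-step {h}     true  false p         = suc h , refl , up∷
prime-step {h}     false false p         = h , refl , none∷
prime-step {suc h} false true  (down∷ p) = h , refl , down∷
prime-step {suc h} false true  (none∷ p) = h , refl , down∷

-- Together with shift-prime and shift-injective: shift true is a bijection
-- from Motzkin paths to nonempty prime paths.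
unshift : ∀ c e z → Prime (carry c h) ((c , e) ∷ z) →
          ∃[ x ] (c , e) ∷ z ≡ shift c x × Motzkin h x
unshift c e [] p with e | prime-tail c e p
... | true | [] = [] , refl , []
unshift c e ((d , e′) ∷ z) p with prime-step d e (prime-tail c e p)
... | h′ , eq , extend
  with x , eq′ , m ← unshift d e′ z (subst (λ k → Prime k ((d , e′) ∷ z)) (sym eq) (prime-tail c e p))
  = (d , e) ∷ x , cong ((c , e) ∷_) eq′ , extend m

------------------------------------------------------------------------
-- Cutting a path at its first return

-- The letter none that follows a prime path is the first one used at
-- height 0.
prime-shortest : Prime h z → Motzkin h x → z ++ none ∷ v ≡ x ++ none ∷ w →
                 length z ℕ.≤ length x
prime-shortest []        q         eq = z≤n
prime-shortest (up∷ p)   (up∷ q)   eq = s≤s (prime-shortest p q (∷-injectiveʳ eq))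
prime-shortest (down∷ p) (down∷ q) eq = s≤s (prime-shortest p q (∷-injectiveʳ eq))
prime-shortest (both∷ p) (both∷ q) eq = s≤s (prime-shortest p q (∷-injectiveʳ eq))
prime-shortest (none∷ p) (none∷ q) eq = s≤s (prime-shortest p q (∷-injectiveʳ eq))

compare-prefix : ∀ z x → length z ℕ.≤ length x → z ++ none ∷ v ≡ x ++ none ∷ w →
                 (z ≡ x × v ≡ w) ⊎ (∃[ u ] x ≡ z ++ none ∷ u × v ≡ u ++ none ∷ w)
compare-prefix []      []      _        eq = inj₁ (refl , ∷-injectiveʳ eq)
compare-prefix []      (l ∷ x) _        eq with refl ← ∷-injectiveˡ eq = inj₂ (x , refl , ∷-injectiveʳ eq)
compare-prefix (l ∷ z) (k ∷ x) (s≤s le) eq with refl ← ∷-injectiveˡ eq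
  with compare-prefix z x le (∷-injectiveʳ eq)
... | inj₁ (refl , eq′)     = inj₁ (refl , eq′)
... | inj₂ (u , refl , eq′) = inj₂ (u , refl , eq′)

-- The words of permutations that avoid 231 will be exactly these. Index n is
-- a descent of no permutation of size n, so the last letter is none.
data Terminated : List Letter → Set where
  empty : Terminated []
  close : Motzkin 0 w → Terminated (w ++ [ none ])

-- Return j w: j is 0 or the number of letters read up to and including some
-- occurrence of none at height 0.
data Return : ℕ → List Letter → Set where
  start : Return 0 w
  after : Motzkin 0 x → Return (suc (length x)) (x ++ none ∷ y)

-- Prepend j w w′: w′ arises from w by applying shift true to the letters
-- before the j-th, which has to be a none at height 0; for j = 0 a none is
-- put in front. It describes the effect on words of putting a new first
-- value j in front of a permutation.
data Prepend : ℕ → List Letter → List Letter → Set where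
  bare  : Prepend 0 w (none ∷ w)
  block : Motzkin 0 x → Prepend (suc (length x)) (x ++ none ∷ y) (shift true x ++ none ∷ y)

-- Cuts a path followed by none after its first none at height 0.
first-return : Motzkin h w →
               ∃[ z ] ∃[ y ] Prime h z × Terminated y × w ++ [ none ] ≡ z ++ none ∷ y
first-return [] = [] , [] , [] , empty , refl
first-return (up∷ m) with z , y , p , t , eq ← first-return m
  = up ∷ z , y , up∷ p , t , cong (_ ∷_) eq
first-return (down∷ m) with z , y , p , t , eq ← first-return m
  = down ∷ z , y , down∷ p , t , cong (_ ∷_) eq
first-return (both∷ m) with z , y , p , t , eq ← first-return m
  = both ∷ z , y , both∷ p , t , cong (_ ∷_) eq
first-return {zero}  (none∷ m) = [] , _ , [] , close m , refl
first-return {suc _} (none∷ m) with z , y , p , t , eq ← first-return m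
  = none ∷ z , y , none∷ p , t , cong (_ ∷_) eq

terminated-++ : Motzkin 0 x → Terminated y → Terminated (x ++ none ∷ y)
terminated-++ m empty = close m
terminated-++ {x} m (close {w} m′) =
  subst Terminated (++-assoc x (none ∷ w) [ none ]) (close (motzkin-++ m (none∷ m′)))

terminated-drop : Motzkin 0 x → Terminated (x ++ none ∷ y) → Terminated y
terminated-drop {x} {y} m t = helper t refl
  where
  initial-length : ∀ (x : List Letter) {y} w → x ++ none ∷ y ≡ w ++ [ none ] → length x ℕ.≤ length w
  initial-length []      w       eq = z≤n
  initial-length (_ ∷ []) [] ()
  initial-length (_ ∷ _ ∷ x) [] ()
  initial-length (_ ∷ x) (_ ∷ w) eq = s≤s (initial-length x w (∷-injectiveʳ eq))

  helper : Terminated v → x ++ none ∷ y ≡ v → Terminated y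
  helper empty eq with () ← ++-conicalʳ x (none ∷ y) eq
  helper (close {w} m′) eq with compare-prefix x w (initial-length x w eq) eq
  ... | inj₁ (refl , refl)     = empty
  ... | inj₂ (u , refl , refl) = close (motzkin-∷⁻ (motzkin-drop m m′))

prepend-terminated : Prepend i w w′ → Terminated w → Terminated w′
prepend-terminated bare      t = terminated-++ [] t
prepend-terminated (block m) t =
  terminated-++ (prime⇒motzkin (shift-prime true m)) (terminated-drop m t)

-- Every nonempty terminated word arises from a shorter one: cut after the
-- first none at height 0 and undo the shift of the part before it.
prepend-surjective : Motzkin 0 w → ∃[ i ] ∃[ v ] Prepend i v (w ++ [ none ]) × Terminated v
prepend-surjective m with first-return m
... | [] , y , p , t , eq = 0 , y , subst (Prepend 0 y) (sym eq) bare , t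
... | (false , e) ∷ z , y , p , t , eq with () ← p
... | (true , e) ∷ z , y , p , t , eq with x , eq′ , m′ ← unshift true e z p =
  suc (length x) , x ++ none ∷ y ,
  subst (Prepend _ _) (sym (trans eq (cong (_++ none ∷ y) eq′))) (block m′) ,
  terminated-++ m′ t

bare≢block : ∀ x → none ∷ w ≢ shift true x ++ y
bare≢block x eq with shift-head true x
... | _ , _ , eq′ with () ← ∷-injectiveˡ (trans eq (cong (_++ _) eq′))

++-none-injective : ∀ z x → length z ≡ length x → z ++ none ∷ v ≡ x ++ none ∷ w → z ≡ x × v ≡ w
++-none-injective []      []      _  eq = refl , ∷-injectiveʳ eq
++-none-injective (l ∷ z) (k ∷ x) le eq
  with refl ← ∷-injectiveˡ eq | refl , eq′ ← ++-none-injective z x (ℕ.suc-injective le) (∷-injectiveʳ eq)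
  = refl , eq′

-- A word determines the prepended value, namely the length of its only prime
-- prefix that is followed by none, and the word before prepending.
prepend-injective : Prepend i v w → Prepend j v′ w → i ≡ j × v ≡ v′
prepend-injective p q = helper p q refl
  where
  helper : Prepend i v w → Prepend j v′ w′ → w ≡ w′ → i ≡ j × v ≡ v′
  helper bare          bare          eq = refl , ∷-injectiveʳ eq
  helper bare          (block {x} m) eq = contradiction eq (bare≢block x)
  helper (block {x} m) bare          eq = contradiction (sym eq) (bare≢block x)
  helper (block {x} m) (block {x′} m′) eq
    with p ← shift-prime true m | p′ ← shift-prime true m′
    with eq₁ , refl ← ++-none-injective (shift true x) (shift true x′)
           (ℕ.≤-antisym (prime-shortest p (prime⇒motzkin p′) eq)
                        (prime-shortest p′ (prime⇒motzkin p) (sym eq))) eq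
    with refl ← shift-injective true x x′ eq₁ = refl , refl

length-++-none : ∀ (x u : List Letter) → length (x ++ none ∷ u) ≡ suc (length x ℕ.+ length u)
length-++-none x u = trans (length-++ x) (ℕ.+-suc (length x) (length u))

length-block : ∀ (x y : List Letter) → length (shift true x ++ none ∷ y) ≡ suc (length (x ++ none ∷ y))
length-block x y = trans (length-++-none (shift true x) y)
  (cong suc (trans (cong (ℕ._+ length y) (length-shift true x)) (sym (length-++-none x y))))

prepend-length : Prepend i w w′ → length w′ ≡ suc (length w)
prepend-length bare              = refl
prepend-length (block {x} {y} _) = length-block x y

prepend-≤ : Prepend i w w′ → i ℕ.≤ length w
prepend-≤ bare              = z≤n
prepend-≤ (block {x} {y} _) =
  subst (suc (length x) ℕ.≤_) (sym (length-++-none x y)) (s≤s (ℕ.m≤m+n (length x) (length y)))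

prepend-return : Prepend i w w′ → Return i w
prepend-return bare      = start
prepend-return (block m) = after m

prepend-functional : Prepend i v w → Prepend i v w′ → w ≡ w′
prepend-functional p q = helper p q refl refl
  where
  helper : Prepend i v w → Prepend j v′ w′ → i ≡ j → v ≡ v′ → w ≡ w′
  helper bare          bare            _  eq = cong (none ∷_) eq
  helper (block {x} _) (block {x′} _) i≡j eq
    with refl , refl ← ++-none-injective x x′ (ℕ.suc-injective i≡j) eq = refl

-- Besides 0, the return points after prepending with i are the old ones from
-- i on, moved by one place.
return-prepend⁻ : Prepend i w w′ → Return (suc j) w′ → i ℕ.≤ j × Return j w
return-prepend⁻ p r = helper p r refl refl
  where
  helper : ∀ {k} → Prepend i w w′ → Return k v → v ≡ w′ → k ≡ suc j → i ℕ.≤ j × Return j w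
  helper bare (after {[]} m)    eq refl = z≤n , start
  helper bare (after {l ∷ x} m) eq refl with refl ← ∷-injectiveˡ eq | refl ← ∷-injectiveʳ eq =
    z≤n , after (motzkin-∷⁻ m)
  helper (block {x₀} {y₀} m₀) (after {x} m) eq refl
    with prime-shortest (shift-prime true m₀) m (sym eq)
  ... | le with compare-prefix (shift true x₀) x le (sym eq)
  ... | inj₁ (refl , refl) rewrite length-shift true x₀ = ℕ.≤-refl , after m₀
  ... | inj₂ (u , refl , refl)
    rewrite length-++-none (shift true x₀) u | length-shift true x₀ =
    ℕ.≤-trans (ℕ.m≤m+n (suc (length x₀)) (length u)) (ℕ.n≤1+n _) ,
    subst₂ Return (cong suc (length-++-none x₀ u)) (++-assoc x₀ (none ∷ u) _)
      (after (motzkin-++ m₀ (none∷ (motzkin-∷⁻ (motzkin-drop (prime⇒motzkin (shift-prime true m₀)) m)))))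

return-prepend⁺ : Prepend i w w′ → i ℕ.≤ j → Return j w → Return (suc j) w′
return-prepend⁺ bare              _         start     = after []
return-prepend⁺ bare              _         (after m) = after (none∷ m)
return-prepend⁺ (block m₀) le r = helper m₀ le r refl
  where
  helper : Motzkin 0 x → suc (length x) ℕ.≤ j → Return j w → w ≡ x ++ none ∷ y →
           Return (suc j) (shift true x ++ none ∷ y)
  helper {x₀} {y = y₀} m₀ (s≤s le) (after {x} m) eq with compare-prefix x₀ x le (sym eq)
  ... | inj₁ (refl , refl) =
    subst (λ k → Return (suc k) (shift true x₀ ++ none ∷ y₀)) (length-shift true x₀)
      (after (prime⇒motzkin (shift-prime true m₀)))
  ... | inj₂ (u , refl , refl) =
    subst₂ Return
      (cong suc (trans (length-++-none (shift true x₀) u)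
        (trans (cong (λ k → suc (k ℕ.+ length u)) (length-shift true x₀))
               (cong suc (sym (length-++-none x₀ u))))))
      (++-assoc (shift true x₀) (none ∷ u) _)
      (after (motzkin-++ (prime⇒motzkin (shift-prime true m₀))
                         (none∷ (motzkin-∷⁻ (motzkin-drop m₀ m)))))

------------------------------------------------------------------------
-- Exchanging the colours

-- Complements both descent sets and exchanges them. This fixes up and down
-- and swaps the colours both and none.
flipLetter : Letter → Letter
flipLetter (d , e) = not e , not d

motzkin-flip : Motzkin h w → Motzkin h (map flipLetter w)
motzkin-flip []        = []
motzkin-flip (up∷ m)   = up∷ (motzkin-flip m)
motzkin-flip (down∷ m) = down∷ (motzkin-flip m)
motzkin-flip (both∷ m) = none∷ (motzkin-flip m)
motzkin-flip (none∷ m) = both∷ (motzkin-flip m)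

------------------------------------------------------------------------
-- Order properties of punchIn

punchIn-mono-< : ∀ (j : Fin (suc n)) {k l} → k <ᶠ l → punchIn j k <ᶠ punchIn j l
punchIn-mono-< j k<l = ℕ.≰⇒> λ le → ℕ.<⇒≱ k<l (Fin.punchIn-cancel-≤ j _ _ le)

punchIn-cancel-< : ∀ (j : Fin (suc n)) {k l} → punchIn j k <ᶠ punchIn j l → k <ᶠ l
punchIn-cancel-< j lt = ℕ.≰⇒> λ le → ℕ.<⇒≱ lt (Fin.punchIn-mono-≤ j _ _ le)

punchIn-below : ∀ (j : Fin (suc n)) k → toℕ k ℕ.< toℕ j → punchIn j k <ᶠ j
punchIn-below (suc j) zero    _        = s≤s z≤n
punchIn-below (suc j) (suc k) (s≤s lt) = s≤s (punchIn-below j k lt)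

punchIn-above : ∀ (j : Fin (suc n)) k → toℕ j ℕ.≤ toℕ k → j <ᶠ punchIn j k
punchIn-above zero    k       _        = s≤s z≤n
punchIn-above (suc j) (suc k) (s≤s le) = s≤s (punchIn-above j k le)

punchIn-below⁻ : ∀ (j : Fin (suc n)) k → punchIn j k <ᶠ j → toℕ k ℕ.< toℕ j
punchIn-below⁻ j k lt = ℕ.≰⇒> λ le → ℕ.<-asym lt (punchIn-above j k le)

punchIn-above⁻ : ∀ (j : Fin (suc n)) k → j <ᶠ punchIn j k → toℕ j ℕ.≤ toℕ k
punchIn-above⁻ j k lt = ℕ.≮⇒≥ λ k<j → ℕ.<-asym lt (punchIn-below j k k<j)

punchIn-<suc : ∀ {j} (i : Fin (suc n)) k → toℕ i ℕ.≤ j → toℕ k ℕ.< j → toℕ (punchIn i k) ℕ.< suc j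
punchIn-<suc         zero    k       _        lt       = s≤s lt
punchIn-<suc         (suc i) zero    _        lt       = s≤s z≤n
punchIn-<suc {j = suc j} (suc i) (suc k) (s≤s le) (s≤s lt) = s≤s (punchIn-<suc i k le lt)

punchIn-<suc⁻ : ∀ {j} (i : Fin (suc n)) k → toℕ i ℕ.≤ j → toℕ (punchIn i k) ℕ.< suc j → toℕ k ℕ.< j
punchIn-<suc⁻             zero    k       _        (s≤s lt) = lt
punchIn-<suc⁻ {j = suc j} (suc i) zero    _        lt       = s≤s z≤n
punchIn-<suc⁻ {j = suc j} (suc i) (suc k) (s≤s le) (s≤s lt) = s≤s (punchIn-<suc⁻ i k le lt)

------------------------------------------------------------------------
-- First values of 231-avoiding permutations

-- The values below j occupy an initial segment of positions.
SmallFirst : ℕ → Permutation′ n → Set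
SmallFirst j ρ = ∀ {i k} → i <ᶠ k → toℕ (ρ ⟨$⟩ʳ k) ℕ.< j → toℕ (ρ ⟨$⟩ʳ i) ℕ.< j

-- With first value j, a pattern 231 that uses the first position is a value
-- above j followed by a value below j.
avoids-insert⁻ : ∀ j (ρ : Permutation′ n) → Avoids231 (insert zero j ρ) →
                 Avoids231 ρ × SmallFirst (toℕ j) ρ
avoids-insert⁻ j ρ av =
  (λ (i , k , l , i<k , k<l , ρl<ρi , ρi<ρk) →
    av (suc i , suc k , suc l , s≤s i<k , s≤s k<l , punchIn-mono-< j ρl<ρi , punchIn-mono-< j ρi<ρk)) ,
  (λ {i} {k} i<k ρk<j → ℕ.≰⇒> λ j≤ρi →
    av (zero , suc i , suc k , s≤s z≤n , s≤s i<k ,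
        punchIn-below j _ ρk<j , punchIn-above j _ j≤ρi))

avoids-insert⁺ : ∀ j (ρ : Permutation′ n) → Avoids231 ρ → SmallFirst (toℕ j) ρ →
                 Avoids231 (insert zero j ρ)
avoids-insert⁺ j ρ av sf (zero , suc k , suc l , _ , s≤s k<l , σl<j , j<σk) =
  ℕ.<⇒≱ (sf k<l (punchIn-below⁻ j _ σl<j)) (punchIn-above⁻ j _ j<σk)
avoids-insert⁺ j ρ av sf (suc i , suc k , suc l , s≤s i<k , s≤s k<l , σl<σi , σi<σk) =
  av (i , k , l , i<k , k<l , punchIn-cancel-< j σl<σi , punchIn-cancel-< j σi<σk)

-- Inserting i as first value affects SmallFirst in the way in which prepending
-- with i affects return points. Since the value 0 occurs, SmallFirst (suc j)
-- forces the first value i below suc j.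
smallFirst-insert⁻ : ∀ {j} i (π : Permutation′ n) → SmallFirst (suc j) (insert zero i π) →
                     toℕ i ℕ.≤ j × SmallFirst j π
smallFirst-insert⁻ {j = j} i π sf = i≤j , λ k<l πl<j →
  punchIn-<suc⁻ i _ i≤j (sf (s≤s k<l) (punchIn-<suc i _ i≤j πl<j))
  where
  σ = insert zero i π
  i≤j : toℕ i ℕ.≤ j
  i≤j with σ ⟨$⟩ˡ zero | inverseʳ σ {zero}
  ... | zero  | eq = subst (λ v → toℕ v ℕ.≤ j) (sym eq) z≤n
  ... | suc p | eq = ℕ.s≤s⁻¹ (sf {zero} {suc p} (s≤s z≤n) (subst (λ v → toℕ v ℕ.< suc j) (sym eq) (s≤s z≤n)))

smallFirst-insert⁺ : ∀ {j} i (π : Permutation′ n) → toℕ i ℕ.≤ j → SmallFirst j π →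
                     SmallFirst (suc j) (insert zero i π)
smallFirst-insert⁺ i π i≤j sf {zero}  {suc l} _         _  = s≤s i≤j
smallFirst-insert⁺ i π i≤j sf {suc k} {suc l} (s≤s k<l) lt =
  punchIn-<suc i _ i≤j (sf k<l (punchIn-<suc⁻ i _ i≤j lt))

------------------------------------------------------------------------
-- Descents of sequences

-- Descent indicators of a sequence, including the last position, which is
-- never a descent.
descents : (Fin n → ℕ) → List Bool
descents {zero}        f = []
descents {suc zero}    f = [ false ]
descents {suc (suc n)} f = does (f (suc zero) ℕ.<? f zero) ∷ descents (f ∘ suc)

SameOrder : (f g : Fin n → ℕ) → Set
SameOrder f g = ∀ k l → f k ℕ.< f l ⇔ g k ℕ.< g l

descents-cong : (f g : Fin n → ℕ) → SameOrder f g → descents f ≡ descents g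
descents-cong {zero}        f g same = refl
descents-cong {suc zero}    f g same = refl
descents-cong {suc (suc n)} f g same =
  cong₂ _∷_ (does-⇔ (same (suc zero) zero) (_ ℕ.<? _) (_ ℕ.<? _))
            (descents-cong (f ∘ suc) (g ∘ suc) (λ k l → same (suc k) (suc l)))

-- Inserts true before position k, counted from 0. In use k is at most the
-- length of the list.
insertTrue : ℕ → List Bool → List Bool
insertTrue zero    bs       = true ∷ bs
insertTrue (suc k) []       = [ true ]
insertTrue (suc k) (b ∷ bs) = b ∷ insertTrue k bs

descents-minFirst : (f : Fin n → ℕ) (g : Fin (suc n) → ℕ) →
                    (∀ k → ¬ (g (suc k) ℕ.< g zero)) → SameOrder f (g ∘ suc) →
                    descents g ≡ false ∷ descents f
descents-minFirst {zero}  f g min same = refl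
descents-minFirst {suc n} f g min same =
  cong₂ _∷_ (dec-false (_ ℕ.<? _) (min zero)) (sym (descents-cong f (g ∘ suc) same))

descents-maxFirst : (f : Fin (suc n) → ℕ) (g : Fin (suc (suc n)) → ℕ) →
                    g (suc zero) ℕ.< g zero → SameOrder f (g ∘ suc) →
                    descents g ≡ true ∷ descents f
descents-maxFirst f g max same =
  cong₂ _∷_ (dec-true (_ ℕ.<? _) max) (sym (descents-cong f (g ∘ suc) same))

-- A new minimum placed after position j creates a descent at j. If j was not
-- a descent, no other information changes.
descents-insertMin : (j : Fin n) (f : Fin n → ℕ) (g : Fin (suc n) → ℕ) →
  (∀ k → g (suc j) ℕ.< g (punchIn (suc j) k)) →
  SameOrder f (g ∘ punchIn (suc j)) →
  (∀ k → toℕ k ≡ suc (toℕ j) → f j ℕ.< f k) →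
  descents g ≡ insertTrue (toℕ j) (descents f)
descents-insertMin {suc zero} zero f g min same asc =
  cong (_∷ [ false ]) (dec-true (_ ℕ.<? _) (min zero))
descents-insertMin {suc (suc n)} zero f g min same asc =
  cong₂ _∷_ (dec-true (_ ℕ.<? _) (min zero))
    (cong₂ _∷_ (trans (dec-false (_ ℕ.<? _) (ℕ.<⇒≯ (min (suc zero))))
                      (sym (dec-false (_ ℕ.<? _) (ℕ.<⇒≯ (asc (suc zero) refl)))))
      (sym (descents-cong (f ∘ suc) (λ k → g (suc (suc k))) (λ k l → same (suc k) (suc l)))))
descents-insertMin {suc (suc n)} (suc j) f g min same asc =
  cong₂ _∷_ (sym (does-⇔ (same (suc zero) zero) (_ ℕ.<? _) (_ ℕ.<? _)))
    (descents-insertMin j (f ∘ suc) (g ∘ suc) (λ k → min (suc k))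
      (λ k l → same (suc k) (suc l)) (λ k eq → asc (suc k) (cong suc eq)))

------------------------------------------------------------------------
-- The word of a permutation

-- The one-line notations of a permutation and of its inverse.
values positions : Permutation′ n → Fin n → ℕ
values σ i = toℕ (σ ⟨$⟩ʳ i)
positions σ = values (flip σ)

-- The two descent sets of a permutation, jointly.
word : Permutation′ n → List Letter
word σ = zip (descents (values σ)) (descents (positions σ))

positions-insert-same : ∀ j (ρ : Permutation′ n) → positions (insert zero j ρ) j ≡ 0
positions-insert-same j ρ = cong toℕ (inverseˡ (insert zero j ρ) {zero})

positions-insert-punchIn : ∀ j (ρ : Permutation′ n) k →
  positions (insert zero j ρ) (punchIn j k) ≡ suc (positions ρ k)
positions-insert-punchIn j ρ k = cong toℕ (trans
  (cong (σ ⟨$⟩ˡ_) (cong (punchIn j) (sym (inverseʳ ρ))))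
  (inverseˡ σ {suc (ρ ⟨$⟩ˡ k)}))
  where σ = insert zero j ρ

values-insert-order : ∀ j (ρ : Permutation′ n) →
  SameOrder (values ρ) (values (insert zero j ρ) ∘ suc)
values-insert-order j ρ k l = mk⇔ (punchIn-mono-< j) (punchIn-cancel-< j)

positions-insert-order : ∀ j (ρ : Permutation′ n) →
  SameOrder (positions ρ) (positions (insert zero j ρ) ∘ punchIn j)
positions-insert-order j ρ k l
  rewrite positions-insert-punchIn j ρ k | positions-insert-punchIn j ρ l = mk⇔ s≤s ℕ.s≤s⁻¹

-- If the values below j come first, then a value below j occurs before any
-- value that is at least j.
smallFirst-positions : ∀ {j} (ρ : Permutation′ n) → SmallFirst j ρ →
  ∀ k l → toℕ k ℕ.< j → j ℕ.≤ toℕ l → positions ρ k ℕ.< positions ρ l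
smallFirst-positions {j = j} ρ sf k l k<j j≤l with ℕ.<-cmp (positions ρ k) (positions ρ l)
... | tri< lt _ _ = lt
... | tri≈ _ eq _ = contradiction
  (trans (sym (inverseʳ ρ)) (trans (cong (ρ ⟨$⟩ʳ_) (Fin.toℕ-injective eq)) (inverseʳ ρ)))
  λ k≡l → ℕ.<⇒≱ k<j (subst (λ v → j ℕ.≤ toℕ v) (sym k≡l) j≤l)
... | tri> _ _ gt = contradiction
  (subst (λ v → toℕ v ℕ.< j) (inverseʳ ρ)
    (sf gt (subst (λ v → toℕ v ℕ.< j) (sym (inverseʳ ρ)) k<j)))
  (ℕ.≤⇒≯ j≤l)

-- If the letter at index length x is none, inserting true in front of the
-- second component there and c at the start of the first realises shift c.
zip-insertTrue : ∀ c ds es x {y} → zip ds es ≡ x ++ none ∷ y →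
                 zip (c ∷ ds) (insertTrue (length x) es) ≡ shift c x ++ none ∷ y
zip-insertTrue c (d ∷ ds) (e ∷ es) []      eq = cong ((c , true) ∷_) eq
zip-insertTrue c (d ∷ ds) (e ∷ es) (l ∷ x) eq with refl ← ∷-injectiveˡ eq =
  cong ((c , e) ∷_) (zip-insertTrue d ds es x (∷-injectiveʳ eq))

word-insert-zero : ∀ (ρ : Permutation′ n) → word (insert zero zero ρ) ≡ none ∷ word ρ
word-insert-zero ρ = cong₂ zip
  (descents-minFirst (values ρ) (values (insert zero zero ρ)) (λ k ()) (values-insert-order zero ρ))
  (descents-minFirst (positions ρ) (positions (insert zero zero ρ)) (λ k ()) (positions-insert-order zero ρ))

-- The new first value suc j creates a descent, because SmallFirst and the
-- occurrence of the value 0 force the first value of ρ below suc j. In the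
-- inverse a minimum enters between the values j and j + 1, where there was
-- an ascent.
word-insert-suc : ∀ (j : Fin n) (ρ : Permutation′ n) → SmallFirst (suc (toℕ j)) ρ →
  word (insert zero (suc j) ρ) ≡
  zip (true ∷ descents (values ρ)) (insertTrue (toℕ j) (descents (positions ρ)))
word-insert-suc {suc n} j ρ sf = cong₂ zip
  (descents-maxFirst (values ρ) (values σ)
    (punchIn-below (suc j) (ρ ⟨$⟩ʳ zero) first) (values-insert-order (suc j) ρ))
  (descents-insertMin j (positions ρ) (positions σ)
    (λ k → subst₂ ℕ._<_ (sym (positions-insert-same (suc j) ρ))
                        (sym (positions-insert-punchIn (suc j) ρ k)) (s≤s z≤n))
    (positions-insert-order (suc j) ρ)
    (λ k eq → smallFirst-positions ρ sf j k ℕ.≤-refl (ℕ.≤-reflexive (sym eq))))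
  where
  σ = insert zero (suc j) ρ
  first : toℕ (ρ ⟨$⟩ʳ zero) ℕ.< suc (toℕ j)
  first with ρ ⟨$⟩ˡ zero | inverseʳ ρ {zero}
  ... | zero  | eq = subst (λ v → toℕ v ℕ.< suc (toℕ j)) (sym eq) (s≤s z≤n)
  ... | suc p | eq = sf {zero} {suc p} (s≤s z≤n)
                        (subst (λ v → toℕ v ℕ.< suc (toℕ j)) (sym eq) (s≤s z≤n))

word-insert : ∀ (j : Fin (suc n)) (ρ : Permutation′ n) → SmallFirst (toℕ j) ρ →
  Return (toℕ j) (word ρ) → Prepend (toℕ j) (word ρ) (word (insert zero j ρ))
word-insert zero    ρ sf r = subst (Prepend 0 (word ρ)) (sym (word-insert-zero ρ)) bare
word-insert (suc j) ρ sf r = helper r refl refl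
  where
  helper : ∀ {k w} → Return k w → k ≡ suc (toℕ j) → w ≡ word ρ →
           Prepend (suc (toℕ j)) (word ρ) (word (insert zero (suc j) ρ))
  helper (after {x} {y} m) k≡ w≡ =
    subst₂ (λ i w → Prepend i w (word (insert zero (suc j) ρ))) k≡ w≡
      (subst (Prepend _ _) (sym word≡) (block m))
    where
    word≡ : word (insert zero (suc j) ρ) ≡ shift true x ++ none ∷ y
    word≡ = trans (word-insert-suc j ρ sf)
      (trans (cong (λ i → zip (true ∷ descents (values ρ)) (insertTrue i (descents (positions ρ))))
                   (sym (ℕ.suc-injective k≡)))
             (zip-insertTrue true (descents (values ρ)) (descents (positions ρ)) x (sym w≡)))

------------------------------------------------------------------------
-- Words of 231-avoiding permutations

-- Iterated first values: each entry is the first value, followed by the code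
-- of the pattern of the remaining values.
data Code : ℕ → Set where
  []  : Code 0
  _∷_ : Fin (suc n) → Code n → Code (suc n)

⟦_⟧ : Code n → Permutation′ n
⟦ [] ⟧    = id
⟦ j ∷ c ⟧ = insert zero j ⟦ c ⟧

encode : Permutation′ n → Code n
encode {zero}  σ = []
encode {suc n} σ = (σ ⟨$⟩ʳ zero) ∷ encode (remove zero σ)

⟦encode⟧ : (σ : Permutation′ n) → ⟦ encode σ ⟧ ≈ₚ σ
⟦encode⟧ {suc n} σ zero    = refl
⟦encode⟧ {suc n} σ (suc k) =
  trans (cong (punchIn (σ ⟨$⟩ʳ zero)) (⟦encode⟧ (remove zero σ) k)) (insert-remove zero σ (suc k))

-- For avoiders the condition SmallFirst, which governs the permissible first
-- values, is visible in the word: it says that j is a return point.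
smallFirst⇒return : (c : Code n) → Avoids231 ⟦ c ⟧ → ∀ {j} → j ℕ.≤ n →
                    SmallFirst j ⟦ c ⟧ → Return j (word ⟦ c ⟧)
word-prepend : (i : Fin (suc n)) (c : Code n) → Avoids231 ⟦ i ∷ c ⟧ →
               Prepend (toℕ i) (word ⟦ c ⟧) (word ⟦ i ∷ c ⟧)

smallFirst⇒return c       av {zero}  _          sf = start
smallFirst⇒return (i ∷ c) av {suc j} (s≤s j≤n) sf
  with i≤j , sf′ ← smallFirst-insert⁻ i ⟦ c ⟧ sf =
  return-prepend⁺ (word-prepend i c av) i≤j
    (smallFirst⇒return c (proj₁ (avoids-insert⁻ i ⟦ c ⟧ av)) j≤n sf′)

word-prepend i c av with av′ , sf ← avoids-insert⁻ i ⟦ c ⟧ av =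
  word-insert i ⟦ c ⟧ sf (smallFirst⇒return c av′ (Fin.toℕ≤pred[n] i) sf)

return⇒smallFirst : (c : Code n) → Avoids231 ⟦ c ⟧ → ∀ {j} →
                    Return j (word ⟦ c ⟧) → SmallFirst j ⟦ c ⟧
return⇒smallFirst c       av {zero}  r _ ()
return⇒smallFirst (i ∷ c) av {suc j} r
  with i≤j , r′ ← return-prepend⁻ (word-prepend i c av) r =
  smallFirst-insert⁺ i ⟦ c ⟧ i≤j
    (return⇒smallFirst c (proj₁ (avoids-insert⁻ i ⟦ c ⟧ av)) r′)

code-terminated : (c : Code n) → Avoids231 ⟦ c ⟧ → Terminated (word ⟦ c ⟧)
code-terminated []      av = empty
code-terminated (i ∷ c) av =
  prepend-terminated (word-prepend i c av) (code-terminated c (proj₁ (avoids-insert⁻ i ⟦ c ⟧ av)))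

code-injective : (c d : Code n) → Avoids231 ⟦ c ⟧ → Avoids231 ⟦ d ⟧ →
                 word ⟦ c ⟧ ≡ word ⟦ d ⟧ → c ≡ d
code-injective []      []      _   _   _  = refl
code-injective (i ∷ c) (j ∷ d) avc avd eq
  with i≡j , eq′ ← prepend-injective (word-prepend i c avc)
                     (subst (Prepend (toℕ j) (word ⟦ d ⟧)) (sym eq) (word-prepend j d avd)) =
  cong₂ _∷_ (Fin.toℕ-injective i≡j)
    (code-injective c d (proj₁ (avoids-insert⁻ i ⟦ c ⟧ avc)) (proj₁ (avoids-insert⁻ j ⟦ d ⟧ avd)) eq′)

code-surjective : ∀ n {w} → Terminated w → length w ≡ n →
                  ∃[ c ] Avoids231 ⟦ c ⟧ × word {n} ⟦ c ⟧ ≡ w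
code-surjective zero    empty         _   = [] , (λ { (() , _) }) , refl
code-surjective zero    (close {w} m) len with () ← trans (sym (ℕ.+-comm _ 1)) (trans (sym (length-++ w)) len)
code-surjective (suc n) (close {w} m) len
  with i , v , p , t ← prepend-surjective m
  with len-v ← ℕ.suc-injective (trans (sym (prepend-length p)) len)
  with c , av , refl ← code-surjective n t len-v =
  iF ∷ c , av′ ,
  prepend-functional (word-prepend iF c av′) (subst (λ k → Prepend k _ _) (sym toℕ-iF) p)
  where
  i<1+n = s≤s (subst (i ℕ.≤_) len-v (prepend-≤ p))
  iF    = fromℕ< i<1+n
  toℕ-iF : toℕ iF ≡ i
  toℕ-iF = Fin.toℕ-fromℕ< i<1+n
  av′ : Avoids231 ⟦ iF ∷ c ⟧
  av′ = avoids-insert⁺ iF ⟦ c ⟧ av (return⇒smallFirst c av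
          (subst (λ k → Return k _) (sym toℕ-iF) (prepend-return p)))

------------------------------------------------------------------------
-- Complements of descent sets

-- Negates all bits but the last. On the descent indicators of a permutation
-- of size n this is the complement in the set of indices from 1 to n - 1.
complement : List Bool → List Bool
complement []           = []
complement (b ∷ [])     = [ b ]
complement (b ∷ c ∷ bs) = not b ∷ complement (c ∷ bs)

-- Applies flipLetter to all letters but the last, which is kept.
dual : List Letter → List Letter
dual []          = []
dual (l ∷ [])    = [ l ]
dual (l ∷ k ∷ w) = flipLetter l ∷ dual (k ∷ w)

dual-snoc : ∀ w l → dual (w ++ [ l ]) ≡ map flipLetter w ++ [ l ]
dual-snoc []          l = refl
dual-snoc (k ∷ [])    l = refl
dual-snoc (k ∷ m ∷ w) l = cong (flipLetter k ∷_) (dual-snoc (m ∷ w) l)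

length-dual : ∀ w → length (dual w) ≡ length w
length-dual []          = refl
length-dual (l ∷ [])    = refl
length-dual (l ∷ k ∷ w) = cong suc (length-dual (k ∷ w))

flipLetter-involutive : ∀ l → flipLetter (flipLetter l) ≡ l
flipLetter-involutive up   = refl
flipLetter-involutive down = refl
flipLetter-involutive both = refl
flipLetter-involutive none = refl

dual-involutive : ∀ w → dual (dual w) ≡ w
dual-involutive []              = refl
dual-involutive (l ∷ [])        = refl
dual-involutive (l ∷ k ∷ [])    = cong (_∷ [ k ]) (flipLetter-involutive l)
dual-involutive (l ∷ k ∷ m ∷ w) = cong₂ _∷_ (flipLetter-involutive l) (dual-involutive (k ∷ m ∷ w))

dual-terminated : Terminated w → Terminated (dual w)
dual-terminated empty         = empty
dual-terminated (close {w} m) = subst Terminated (sym (dual-snoc w none)) (close (motzkin-flip m))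

-- Bit lists of length n whose last bit, if any, is false.
data EndsFalse : ℕ → List Bool → Set where
  []   : EndsFalse 0 []
  last : EndsFalse 1 [ false ]
  _∷_  : ∀ b {bs} → EndsFalse (suc n) bs → EndsFalse (suc (suc n)) (b ∷ bs)

descents-endsFalse : (f : Fin n → ℕ) → EndsFalse n (descents f)
descents-endsFalse {zero}        f = []
descents-endsFalse {suc zero}    f = last
descents-endsFalse {suc (suc n)} f = _ ∷ descents-endsFalse (f ∘ suc)

dual-zip : EndsFalse n bs → EndsFalse n cs →
           dual (zip bs cs) ≡ zip (complement cs) (complement bs)
dual-zip []              []              = refl
dual-zip last            last            = refl
dual-zip (b ∷ last)      (c ∷ last)      = refl
dual-zip (b ∷ p@(_ ∷ _)) (c ∷ q@(_ ∷ _)) = cong (_ ∷_) (dual-zip p q)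

proj₁-zip : EndsFalse n bs → EndsFalse n cs → map proj₁ (zip bs cs) ≡ bs
proj₁-zip []      []      = refl
proj₁-zip last    last    = refl
proj₁-zip (b ∷ p) (c ∷ q) = cong (b ∷_) (proj₁-zip p q)

proj₂-zip : EndsFalse n bs → EndsFalse n cs → map proj₂ (zip bs cs) ≡ cs
proj₂-zip []      []      = refl
proj₂-zip last    last    = refl
proj₂-zip (b ∷ p) (c ∷ q) = cong (c ∷_) (proj₂-zip p q)

length-endsFalse : EndsFalse n bs → length bs ≡ n
length-endsFalse []      = refl
length-endsFalse last    = refl
length-endsFalse (b ∷ p) = cong suc (length-endsFalse p)

complement-endsFalse : EndsFalse n bs → EndsFalse n (complement bs)
complement-endsFalse []              = []
complement-endsFalse last            = last
complement-endsFalse (b ∷ last)      = _ ∷ last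
complement-endsFalse (b ∷ p@(_ ∷ _)) = _ ∷ complement-endsFalse p

-- For a set of indices with indicators bs, count bs is its cardinality and
-- weight k bs the sum of its elements when the first index is k.
count : List Bool → ℕ
count []           = 0
count (true ∷ bs)  = suc (count bs)
count (false ∷ bs) = count bs

weight : ℕ → List Bool → ℕ
weight k []           = 0
weight k (true ∷ bs)  = k ℕ.+ weight (suc k) bs
weight k (false ∷ bs) = weight (suc k) bs

count-not : ∀ b cs bs → count (not b ∷ cs) ℕ.+ count (b ∷ bs) ≡ suc (count cs ℕ.+ count bs)
count-not true  cs bs = ℕ.+-suc _ _
count-not false cs bs = refl

count-complement : EndsFalse n bs → count (complement bs) ℕ.+ count bs ≡ n ∸ 1
count-complement []                       = refl
count-complement last                     = refl
count-complement (b ∷ last)               = count-not b [ false ] [ false ]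
count-complement (b ∷ p@(_∷_ c {bs} _)) =
  trans (count-not b (complement (c ∷ bs)) (c ∷ bs)) (cong suc (count-complement p))

weight-not : ∀ k b cs bs → weight k (not b ∷ cs) ℕ.+ weight k (b ∷ bs) ≡
                           k ℕ.+ (weight (suc k) cs ℕ.+ weight (suc k) bs)
weight-not k true  cs bs =
  solve 3 (λ k x y → x :+ (k :+ y) := k :+ (x :+ y)) refl k (weight (suc k) cs) (weight (suc k) bs)
  where open +-*-Solver
weight-not k false cs bs = ℕ.+-assoc k _ _

choose-suc : ∀ k → suc k C 2 ≡ k ℕ.+ k C 2
choose-suc k = trans (sym (nCk+nC[k+1]≡[n+1]C[k+1] k 1)) (cong (ℕ._+ k C 2) (nC1≡n k))

weight-step : ∀ k b cs bs {n} →
  weight (suc k) cs ℕ.+ weight (suc k) bs ℕ.+ suc k C 2 ≡ (n ℕ.+ suc k) C 2 →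
  weight k (not b ∷ cs) ℕ.+ weight k (b ∷ bs) ℕ.+ k C 2 ≡ (suc n ℕ.+ k) C 2
weight-step k b cs bs {n} eq = begin
  weight k (not b ∷ cs) ℕ.+ weight k (b ∷ bs) ℕ.+ k C 2
    ≡⟨ cong (ℕ._+ k C 2) (weight-not k b cs bs) ⟩
  k ℕ.+ (W′ ℕ.+ W) ℕ.+ k C 2
    ≡⟨ solve 3 (λ k s c → k :+ s :+ c := s :+ (k :+ c)) refl k (W′ ℕ.+ W) (k C 2) ⟩
  W′ ℕ.+ W ℕ.+ (k ℕ.+ k C 2)
    ≡⟨ cong (W′ ℕ.+ W ℕ.+_) (choose-suc k) ⟨
  W′ ℕ.+ W ℕ.+ suc k C 2
    ≡⟨ eq ⟩
  (n ℕ.+ suc k) C 2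
    ≡⟨ cong (_C 2) (ℕ.+-suc n k) ⟩
  (suc n ℕ.+ k) C 2 ∎
  where
  open ≡-Reasoning
  open +-*-Solver
  W′ = weight (suc k) cs
  W  = weight (suc k) bs

-- For n at least 1, the two complementary sets contain each of the indices
-- k, ..., k + n - 2 once, and these add up to (n - 1 + k) C 2 - k C 2.
weight-complement : ∀ k → EndsFalse n bs →
  weight k (complement bs) ℕ.+ weight k bs ℕ.+ k C 2 ≡ (n ∸ 1 ℕ.+ k) C 2
weight-complement k []         = refl
weight-complement k last       = refl
weight-complement k (b ∷ last) = weight-step k b [ false ] [ false ] {0} refl
weight-complement k (b ∷ p@(_∷_ {n = m} c {bs} _)) =
  weight-step k b (complement (c ∷ bs)) (c ∷ bs) {suc m} (weight-complement (suc k) p)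

count-complement′ : EndsFalse n bs → count (complement bs) ≡ n ∸ 1 ∸ count bs
count-complement′ {bs = bs} p =
  trans (sym (ℕ.m+n∸n≡m _ (count bs))) (cong (_∸ count bs) (count-complement p))

weight-complement′ : EndsFalse n bs → weight 1 (complement bs) ≡ n C 2 ∸ weight 1 bs
weight-complement′ {zero}  []         = refl
weight-complement′ {suc n} {bs = bs} p =
  trans (sym (ℕ.m+n∸n≡m _ (weight 1 bs)))
    (cong (_∸ weight 1 bs)
      (trans (sym (ℕ.+-identityʳ _))
        (trans (weight-complement 1 p) (cong (_C 2) (ℕ.+-comm n 1)))))

------------------------------------------------------------------------
-- Statistics in terms of descent indicators

-- The decision procedure is arbitrary so that the induction can pass to the
-- tail of the sequence.
tabulate-isDescent : (g : Fin n → ℕ) →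
  (g? : ∀ i → Dec (∃[ j ] toℕ j ≡ suc (toℕ i) × g j ℕ.< g i)) →
  tabulate (does ∘ g?) ≡ descents g
tabulate-isDescent {zero}        g g? = refl
tabulate-isDescent {suc zero}    g g? = cong [_] (dec-false (g? zero) λ { (zero , () , _) })
tabulate-isDescent {suc (suc n)} g g? = cong₂ _∷_
  (does-⇔ (mk⇔ (λ { (suc zero , _ , lt) → lt }) (λ lt → suc zero , refl , lt)) (g? zero) (_ ℕ.<? _))
  (tabulate-isDescent (g ∘ suc) λ i → Dec.map
    (mk⇔ (λ { (suc j , eq , lt) → j , ℕ.suc-injective eq , lt })
         (λ { (j , eq , lt) → suc j , cong suc eq , lt })) (g? (suc i)))

module _ {A : Set} {P : A → Set} (P? : ∀ x → Dec (P x)) where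
  length-filter-tabulate : (f : Fin n → A) →
    length (filter P? (tabulate f)) ≡ count (tabulate (does ∘ P? ∘ f))
  length-filter-tabulate {zero}  f = refl
  length-filter-tabulate {suc n} f with does (P? (f zero))
  ... | true  = cong suc (length-filter-tabulate (f ∘ suc))
  ... | false = length-filter-tabulate (f ∘ suc)

  sum-filter-tabulate : ∀ k (u : A → ℕ) (f : Fin n → A) → (∀ i → u (f i) ≡ k ℕ.+ toℕ i) →
    ℕ.sum (map u (filter P? (tabulate f))) ≡ weight k (tabulate (does ∘ P? ∘ f))
  sum-filter-tabulate {zero}  k u f eq = refl
  sum-filter-tabulate {suc n} k u f eq with does (P? (f zero))
    | sum-filter-tabulate (suc k) u (f ∘ suc) (λ i → trans (eq (suc i)) (ℕ.+-suc k (toℕ i)))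
  ... | true  | ih = cong₂ ℕ._+_ (trans (eq zero) (ℕ.+-identityʳ k)) ih
  ... | false | ih = ih

des≡count : (σ : Permutation′ n) → des σ ≡ count (descents (values σ))
des≡count σ = trans (length-filter-tabulate (isDescent? σ) (λ i → i))
  (cong count (tabulate-isDescent (values σ) (isDescent? σ)))

maj≡weight : (σ : Permutation′ n) → maj σ ≡ weight 1 (descents (values σ))
maj≡weight σ = trans (sum-filter-tabulate (isDescent? σ) 1 (λ i → suc (toℕ i)) (λ i → i) (λ i → refl))
  (cong (weight 1) (tabulate-isDescent (values σ) (isDescent? σ)))

------------------------------------------------------------------------
-- The words of the two classes

flip-cong : {σ τ : Permutation′ n} → σ ≈ₚ τ → flip σ ≈ₚ flip τ
flip-cong {σ = σ} {τ} σ≈τ i =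
  trans (sym (inverseˡ τ)) (cong (τ ⟨$⟩ˡ_) (trans (sym (σ≈τ (σ ⟨$⟩ˡ i))) (inverseʳ σ)))

descents-ext : {f g : Fin n → ℕ} → (∀ i → f i ≡ g i) → descents f ≡ descents g
descents-ext {f = f} {g} f≗g = descents-cong f g λ k l →
  mk⇔ (subst₂ ℕ._<_ (f≗g k) (f≗g l)) (subst₂ ℕ._<_ (sym (f≗g k)) (sym (f≗g l)))

word-cong : {σ τ : Permutation′ n} → σ ≈ₚ τ → word σ ≡ word τ
word-cong {σ = σ} {τ} σ≈τ = cong₂ zip (descents-ext (cong toℕ ∘ σ≈τ))
                                      (descents-ext (cong toℕ ∘ flip-cong {σ = σ} {τ} σ≈τ))

avoids231-cong : {σ τ : Permutation′ n} → σ ≈ₚ τ → Avoids231 σ → Avoids231 τ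
avoids231-cong σ≈τ av (i , j , k , i<j , j<k , τk<τi , τi<τj) =
  av (i , j , k , i<j , j<k , subst₂ _<ᶠ_ (sym (σ≈τ k)) (sym (σ≈τ i)) τk<τi
                            , subst₂ _<ᶠ_ (sym (σ≈τ i)) (sym (σ≈τ j)) τi<τj)

word-terminated : (σ : Permutation′ n) → Avoids231 σ → Terminated (word σ)
word-terminated σ av = subst Terminated (word-cong {σ = ⟦ encode σ ⟧} {σ} (⟦encode⟧ σ))
  (code-terminated (encode σ) (avoids231-cong {σ = σ} {⟦ encode σ ⟧} (sym ∘ ⟦encode⟧ σ) av))

word-injective : (σ τ : Permutation′ n) → Avoids231 σ → Avoids231 τ → word σ ≡ word τ → σ ≈ₚ τ
word-injective σ τ avσ avτ eq i = trans (sym (⟦encode⟧ σ i))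
  (trans (cong (λ c → ⟦ c ⟧ ⟨$⟩ʳ i) same) (⟦encode⟧ τ i))
  where
  same : encode σ ≡ encode τ
  same = code-injective (encode σ) (encode τ)
    (avoids231-cong {σ = σ} {⟦ encode σ ⟧} (sym ∘ ⟦encode⟧ σ) avσ)
    (avoids231-cong {σ = τ} {⟦ encode τ ⟧} (sym ∘ ⟦encode⟧ τ) avτ)
    (trans (word-cong {σ = ⟦ encode σ ⟧} {σ} (⟦encode⟧ σ))
      (trans eq (sym (word-cong {σ = ⟦ encode τ ⟧} {τ} (⟦encode⟧ τ)))))

length-word : (σ : Permutation′ n) → length (word σ) ≡ n
length-word σ = trans (length-zipWith _,_ (descents (values σ)) (descents (positions σ)))
  (trans (cong₂ ℕ._⊓_ (length-endsFalse (descents-endsFalse (values σ)))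
                      (length-endsFalse (descents-endsFalse (positions σ)))) (ℕ.⊓-idem _))

flip-avoids231 : (τ : Permutation′ n) → Avoids312 τ → Avoids231 (flip τ)
flip-avoids231 τ av (i , j , k , i<j , j<k , τk<τi , τi<τj) =
  av (τ ⟨$⟩ˡ k , τ ⟨$⟩ˡ i , τ ⟨$⟩ˡ j , τk<τi , τi<τj ,
      subst₂ _<ᶠ_ (sym (inverseʳ τ)) (sym (inverseʳ τ)) i<j ,
      subst₂ _<ᶠ_ (sym (inverseʳ τ)) (sym (inverseʳ τ)) j<k)

flip-avoids312 : (σ : Permutation′ n) → Avoids231 σ → Avoids312 (flip σ)
flip-avoids312 σ av (i , j , k , i<j , j<k , σj<σk , σk<σi) =
  av (σ ⟨$⟩ˡ j , σ ⟨$⟩ˡ k , σ ⟨$⟩ˡ i , σj<σk , σk<σi ,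
      subst₂ _<ᶠ_ (sym (inverseʳ σ)) (sym (inverseʳ σ)) i<j ,
      subst₂ _<ᶠ_ (sym (inverseʳ σ)) (sym (inverseʳ σ)) j<k)

avoids312-cong : {σ τ : Permutation′ n} → σ ≈ₚ τ → Avoids312 σ → Avoids312 τ
avoids312-cong σ≈τ av (i , j , k , i<j , j<k , τj<τk , τk<τi) =
  av (i , j , k , i<j , j<k , subst₂ _<ᶠ_ (sym (σ≈τ j)) (sym (σ≈τ k)) τj<τk
                            , subst₂ _<ᶠ_ (sym (σ≈τ k)) (sym (σ≈τ i)) τk<τi)

-- The inverse of τ has the two descent sets of τ in reversed order, and dual
-- exchanges them again: this word lists the complements of the descent sets
-- of τ and of its inverse, in this order.
dualWord : Permutation′ n → List Letter
dualWord τ = dual (word (flip τ))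

module _ {A B : Set} {P : A → Set} (P? : ∀ x → Dec (P x)) {R : A → A → Set} (f : A → B)
         (inj : ∀ {x y} → P x → P y → f x ≡ f y → R x y) where
  unique-map-filter : ∀ {xs} → AllPairs (λ x y → ¬ R x y) xs → Unique (map f (filter P? xs))
  unique-map-filter {xs} pairs = AllPairs.map⁺ (helper (All.all-filter P? xs) (AllPairs.filter⁺ P? pairs))
    where
    helper : ∀ {ys} → All P ys → AllPairs (λ x y → ¬ R x y) ys → AllPairs (λ x y → f x ≢ f y) ys
    helper []         []         = []
    helper (px ∷ pxs) (rx ∷ rxs) =
      All.zipWith (λ (py , ¬r) eq → ¬r (inj px py eq)) (pxs , rx) ∷ helper pxs rxs

listed : (σ : Permutation′ n) → ∃[ τ ] τ ∈ permutations n × σ ≈ₚ τ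
listed {n} σ = find (permutations-complete n σ)

-- If f maps the permutations with P onto the terminated words of length n,
-- then so it does with the listed ones, each σ being listed only up to ≈ₚ.
module _ {P : Permutation′ n → Set} (P? : ∀ σ → Dec (P σ)) (f : Permutation′ n → List Letter)
  (sound : ∀ σ → P σ → Terminated (f σ) × length (f σ) ≡ n)
  (onto : ∀ {w} → Terminated w → length w ≡ n → ∃[ σ ] P σ × f σ ≡ w)
  (P-cong : ∀ σ τ → σ ≈ₚ τ → P σ → P τ) (f-cong : ∀ σ τ → σ ≈ₚ τ → f σ ≡ f τ) where
  ∈-words : ∀ {w} → w ∈ map f (filter P? (permutations n)) ⇔ (Terminated w × length w ≡ n)
  ∈-words {w} = mk⇔ fwd bwd
    where
    fwd : w ∈ map f (filter P? (permutations n)) → Terminated w × length w ≡ n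
    fwd w∈ with σ , σ∈ , refl ← ∈-map⁻ f w∈ = sound σ (proj₂ (∈-filter⁻ P? {xs = permutations n} σ∈))
    bwd : Terminated w × length w ≡ n → w ∈ map f (filter P? (permutations n))
    bwd (t , len) with σ , p , refl ← onto t len with τ , τ∈ , σ≈τ ← listed σ =
      subst (_∈ map f (filter P? (permutations n))) (sym (f-cong σ τ σ≈τ))
        (∈-map⁺ f (∈-filter⁺ P? τ∈ (P-cong σ τ σ≈τ p)))

𝒮₂₃₁-words : ∀ {w} → w ∈ map word (𝒮₂₃₁ n) ⇔ (Terminated w × length w ≡ n)
𝒮₂₃₁-words {n} = ∈-words avoids231? word
  (λ σ av → word-terminated σ av , length-word σ)
  (λ t len → let c , av , eq = code-surjective n t len in ⟦ c ⟧ , av , eq)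
  (λ σ τ → avoids231-cong {σ = σ} {τ}) (λ σ τ → word-cong {σ = σ} {τ})

𝒮₃₁₂-words : ∀ {w} → w ∈ map dualWord (𝒮₃₁₂ n) ⇔ (Terminated w × length w ≡ n)
𝒮₃₁₂-words {n} = ∈-words avoids312? dualWord
  (λ τ av → dual-terminated (word-terminated (flip τ) (flip-avoids231 τ av)) ,
            trans (length-dual (word (flip τ))) (length-word (flip τ)))
  (λ {w} t len →
    let c , av , eq = code-surjective n (dual-terminated t) (trans (length-dual w) len)
    in flip ⟦ c ⟧ , flip-avoids312 ⟦ c ⟧ av , trans (cong dual eq) (dual-involutive w))
  (λ σ τ → avoids312-cong {σ = σ} {τ})
  (λ σ τ σ≈τ → cong dual (word-cong {σ = flip σ} {flip τ} (flip-cong {σ = σ} {τ} σ≈τ)))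

-- Both sides list every terminated word of length n exactly once.
words-↭ : ∀ n → map word (𝒮₂₃₁ n) ↭ map dualWord (𝒮₃₁₂ n)
words-↭ n = ∼bag⇒↭ (unique∧set⇒bag
  (unique-map-filter avoids231? word (λ {σ} {τ} → word-injective σ τ) (permutations-unique n))
  (unique-map-filter avoids312? dualWord (λ {σ} {τ} → dualWord-injective σ τ) (permutations-unique n))
  (⇔-trans 𝒮₂₃₁-words (⇔-sym 𝒮₃₁₂-words)))
  where
  dualWord-injective : (σ τ : Permutation′ n) → Avoids312 σ → Avoids312 τ →
                       dualWord σ ≡ dualWord τ → σ ≈ₚ τ
  dualWord-injective σ τ avσ avτ eq = flip-cong {σ = flip σ} {flip τ}
    (word-injective (flip σ) (flip τ) (flip-avoids231 σ avσ) (flip-avoids231 τ avτ)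
      (trans (sym (dual-involutive _)) (trans (cong dual eq) (dual-involutive _))))

------------------------------------------------------------------------
-- Polynomials as lists of monomials

-- The term with coefficient 1 and exponents i, j, k of a, q and t.
monomial : ℕ → ℕ → ℕ → ℤ × Vec ℕ 3
monomial i j k = 1ℤ , i ∷ j ∷ k ∷ []

a^≡ : ∀ i → a ^ i ≡ [ monomial i 0 0 ]
a^≡ zero    = refl
a^≡ (suc i) = cong (a *_) (a^≡ i)

q^≡ : ∀ j → q ^ j ≡ [ monomial 0 j 0 ]
q^≡ zero    = refl
q^≡ (suc j) = cong (q *_) (q^≡ j)

t^≡ : ∀ k → t ^ k ≡ [ monomial 0 0 k ]
t^≡ zero    = refl
t^≡ (suc k) = cong (t *_) (t^≡ k)

monomial≡ : ∀ i j k → a ^ i * q ^ j * t ^ k ≡ [ monomial i j k ]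
monomial≡ i j k rewrite a^≡ i | q^≡ j | t^≡ k
  | ℕ.+-identityʳ i | ℕ.+-identityʳ i | ℕ.+-identityʳ j = refl

sumOver-singletons : ∀ {A : Set} {k} (f : A → Polynomial k) (m : A → ℤ × Vec ℕ k) →
                     (∀ x → f x ≡ [ m x ]) → ∀ xs → sumOver xs f ≡ map m xs
sumOver-singletons f m eq []       = refl
sumOver-singletons f m eq (x ∷ xs) = cong₂ _++_ (eq x) (sumOver-singletons f m eq xs)

-- Reordering the terms of a presentation does not change the polynomial.
coefficient-↭ : ∀ {k} {p r : Polynomial k} → p ↭ r → p ≈ r
coefficient-↭ p↭r e = ↭ₛ.foldr-commMonoid (setoid ℤ) ℤ.+-0-isCommutativeMonoid
  (↭⇒↭ₛ (↭-map⁺ proj₁ (filter-↭ (λ term → Vec.≡-dec ℕ._≟_ (proj₂ term) e) p↭r)))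

-- The exponents of a, q and t, computed from the two descent sets.
wordMonomial : List Letter → ℤ × Vec ℕ 3
wordMonomial w = monomial (count (map proj₁ w)) (weight 1 (map proj₁ w)) (weight 1 (map proj₂ w))

monomial-cong : ∀ {i i′ j j′ k k′} → i ≡ i′ → j ≡ j′ → k ≡ k′ → monomial i j k ≡ monomial i′ j′ k′
monomial-cong refl refl refl = refl

wordMonomial-word : (σ : Permutation′ n) → a ^ des σ * q ^ maj σ * t ^ imaj σ ≡ [ wordMonomial (word σ) ]
wordMonomial-word σ = trans (monomial≡ (des σ) (maj σ) (imaj σ)) (cong [_] (monomial-cong
  (trans (des≡count σ) (cong count (sym ds≡)))
  (trans (maj≡weight σ) (cong (weight 1) (sym ds≡)))
  (trans (maj≡weight (flip σ)) (cong (weight 1) (sym es≡)))))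
  where
  ds = descents-endsFalse (values σ)
  es = descents-endsFalse (positions σ)
  ds≡ = proj₁-zip ds es
  es≡ = proj₂-zip ds es

wordMonomial-dualWord : (τ : Permutation′ n) →
  a ^ (n ∸ 1 ∸ des τ) * q ^ (n C 2 ∸ maj τ) * t ^ (n C 2 ∸ imaj τ) ≡ [ wordMonomial (dualWord τ) ]
wordMonomial-dualWord {n} τ =
  trans (monomial≡ (n ∸ 1 ∸ des τ) (n C 2 ∸ maj τ) (n C 2 ∸ imaj τ)) (cong [_] (monomial-cong
    (trans (cong (n ∸ 1 ∸_) (des≡count τ)) (trans (sym (count-complement′ ds)) (cong count (sym ds≡))))
    (trans (cong (n C 2 ∸_) (maj≡weight τ)) (trans (sym (weight-complement′ ds)) (cong (weight 1) (sym ds≡))))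
    (trans (cong (n C 2 ∸_) (maj≡weight (flip τ)))
      (trans (sym (weight-complement′ es)) (cong (weight 1) (sym es≡))))))
  where
  ds  = descents-endsFalse (values τ)
  es  = descents-endsFalse (positions τ)
  ds≡ = trans (cong (map proj₁) (dual-zip es ds)) (proj₁-zip (complement-endsFalse ds) (complement-endsFalse es))
  es≡ = trans (cong (map proj₂) (dual-zip es ds)) (proj₂-zip (complement-endsFalse ds) (complement-endsFalse es))

theorem4p4 : ∀ (n : ℕ) → n ≥ 1 →
    ∑[ σ ∈ 𝒮₂₃₁ n ] (a ^ des σ * q ^ maj σ * t ^ imaj σ)
    ≈
    ∑[ σ ∈ 𝒮₃₁₂ n ] (a ^ (n ∸ 1 ∸ des σ) * q ^ (n C 2 ∸ maj σ) * t ^ (n C 2 ∸ imaj σ))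
theorem4p4 n _
  rewrite sumOver-singletons _ (wordMonomial ∘ word) wordMonomial-word (𝒮₂₃₁ n)
        | sumOver-singletons _ (wordMonomial ∘ dualWord) wordMonomial-dualWord (𝒮₃₁₂ n)
        | map-∘ {g = wordMonomial} {word} (𝒮₂₃₁ n)
        | map-∘ {g = wordMonomial} {dualWord} (𝒮₃₁₂ n)
  = coefficient-↭ (↭-map⁺ wordMonomial (words-↭ n))
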